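{- Let $c \geq 2$ and $s \geq 1$ be integers. When $s \geq 2$ let $x = \lfloor \log_c (s-1) \rfloor$. Then the complete bipartite graph $K_{s,t}$ (with parts of sizes $s$ and $t$) has an identity $c$-edge coloring if and only if exactly one of the following holds: (i) $s = 1$ and $2 \leq t \leq c$; (ii) $2 \leq s \leq c$ and $1 \leq t \leq c^s - 1$, except for the case $c = s = t = 2$; (iii) $s > c$ and $s \leq c^{1+x} - \lfloor \log_c x \rfloor - 2$ and $x+1 \leq t \leq c^s - x - 1$; (iv) $s > c$ and $s \geq c^{1+x} - \lfloor \log_c x \rfloor$ and $x+2 \leq t \leq c^s - x - 2$; (v) $s > c$ and $s = c^{1+x} - \lfloor \log_c x \rfloor - 1$ and either $x+2 \leq t \leq c^s - x - 2$, or $t \in \{x+1,\ c^s - x - 1\}$ and $K_{x+1,s}$ has an identity $c$-edge coloring; except for the case $c = 2$ and $s = t = 3$.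
   Context: A $c$-edge coloring of a graph assigns to each edge one of $c$ colors. A (color-preserving) automorphism of an edge-colored graph is a bijection $\phi$ of the vertex set to itself such that for all vertices $u,v$, $uv$ is an edge iff $\phi(u)\phi(v)$ is an edge, and then the edge $uv$ and the edge $\phi(u)\phi(v)$ have the same color. (For $K_{s,s}$, automorphisms may interchange the two parts.) An identity $c$-edge coloring is a $c$-edge coloring whose only color-preserving automorphism is the identity. -}

module Defs where

open import Data.Nat using (ℕ; zero; suc; _+_; _*_; _∸_; _^_; _≤_; _<_; _≤ᵇ_; _/_)
open import Data.Nat.DivMod
open import Data.Bool using (Bool; true; false; if_then_else_)
open import Data.Fin using (Fin)
open import Data.Sum using (_⊎_; inj₁; inj₂)
open import Data.Product using (Σ; ∃; _×_; _,_)
open import Data.Maybe using (Maybe; just; nothing)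
open import Function.Bundles using (_↔_; Inverse)
open import Relation.Binary.PropositionalEquality using (_≡_)

-- floor of log base c of n (for c ≥ 2, n ≥ 1): the largest k with c ^ k ≤ n.
-- Computed by repeated division with fuel n (enough since c ≥ 2).
-- (Conventional value 0 for n = 0 or c < 2; never used in the theorem.)
flogAux : ℕ → ℕ → ℕ → ℕ
flogAux zero    c       n = 0
flogAux (suc f) zero    n = 0
flogAux (suc f) (suc k) n =
  if suc k ≤ᵇ n then suc (flogAux f (suc k) (n / suc k)) else 0

⌊log_⌋ : ℕ → ℕ → ℕ
⌊log c ⌋ n = flogAux n c n

Vertex : ℕ → ℕ → Set
Vertex s t = Fin s ⊎ Fin t

EdgeColouring : ℕ → ℕ → ℕ → Set
EdgeColouring c s t = Fin s → Fin t → Fin c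

edgeCol : ∀ {c s t} → EdgeColouring c s t → Vertex s t → Vertex s t → Maybe (Fin c)
edgeCol χ (inj₁ i) (inj₁ i′) = nothing
edgeCol χ (inj₁ i) (inj₂ j)  = just (χ i j)
edgeCol χ (inj₂ j) (inj₁ i)  = just (χ i j)
edgeCol χ (inj₂ j) (inj₂ j′) = nothing

-- A colour-preserving automorphism: a bijection φ of the vertex set such that
-- uv is an edge iff φ(u)φ(v) is an edge, and then they have the same colour.
-- (Both conditions together are exactly: edgeCol χ (φ u) (φ v) ≡ edgeCol χ u v.)
IsColourAutomorphism : ∀ {c s t} → EdgeColouring c s t → (Vertex s t ↔ Vertex s t) → Set
IsColourAutomorphism χ φ =
  ∀ u v → edgeCol χ (Inverse.to φ u) (Inverse.to φ v) ≡ edgeCol χ u v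

IsIdentityColouring : ∀ {c s t} → EdgeColouring c s t → Set
IsIdentityColouring {s = s} {t = t} χ =
  (φ : Vertex s t ↔ Vertex s t) → IsColourAutomorphism χ φ → ∀ v → Inverse.to φ v ≡ v

HasIdentityColouring : ℕ → ℕ → ℕ → Set
HasIdentityColouring c s t = Σ (EdgeColouring c s t) IsIdentityColouring

{-# OPTIONS --safe #-}

-- Call an s × t matrix of colours rigid if no nontrivial permutation of its rows
-- and columns preserves it.  For s ≠ t this is an identity colouring; for s = t one
-- must also exclude the automorphisms that interchange the two parts.
--
-- A rigid matrix has distinct columns, so it is a t-element set of columns among
-- the c ^ s possible ones, and the complementary set is rigid as well; so is the
-- transpose.  Distinctness of the rows, for the matrix and for its complement,
-- gives x + 1 ≤ t ≤ c ^ s - x - 1.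
--
-- Conversely, distinct columns together with distinct row sums imply rigidity.  A
-- staircase of s - 1 columns has distinct row sums, and these stay distinct when
-- one adds columns contributing equally to all rows: constant columns and orbits of
-- columns under adding a constant to all entries modulo c.  With complements, this
-- reaches every t with s - 1 ≤ t ≤ c ^ s - (s - 1), and transposition extends it to
-- x + 2 ≤ t ≤ c ^ s - x - 2.  The value t = x + 1 (and dually c ^ s - x - 1) is
-- settled by applying both directions to the transposed size (x + 1) × s.
module Submission where

open import Defs
open import Data.Nat using (ℕ; zero; suc; _+_; _∸_; _*_; _^_; _/_; _≤_; _<_; _≤ᵇ_;
  z≤n; s≤s; s≤s⁻¹; >-nonZero)
open import Data.Nat.Properties
open import Data.Nat.DivMod using (_%_; _mod_; %-distribˡ-+; m%n%n≡m%n; [m+n]%n≡m%n; m<n⇒m%n≡m;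
  m%n<n; m≡m%n+[m/n]*n; m/n*n≤m; m/n<m; m≥n⇒m/n>0)
open import Algebra.Properties.CommutativeMonoid.Sum +-0-commutativeMonoid
  using (sum; sum-permute; sum-cong-≗; sum-replicate-zero)
open import Data.Bool using (true; false; T)
open import Data.Empty using (⊥-elim)
open import Data.Fin as Fin using (Fin; zero; suc; toℕ; _↑ˡ_; _↑ʳ_; splitAt; combine; remQuot;
  punchIn; punchOut; finToFun; funToFin; inject≤)
open import Data.Fin.Patterns
open import Data.Fin.Permutation as Perm using (Permutation; permutation; _⟨$⟩ʳ_; _⟨$⟩ˡ_; flip; transpose; _∘ₚ_)
import Data.Fin.Properties as Fin
open import Data.List using (List; []; _∷_; cartesianProduct)
open import Data.List.Relation.Unary.Any as Any using (Any; any?)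
open import Data.Maybe using (just)
open import Data.Maybe.Properties using (just-injective)
open import Data.Product using (Σ; ∃-syntax; ∃₂; _×_; _,_; proj₁; proj₂; map₂; uncurry)
open import Data.Sum as Sum using (_⊎_; inj₁; inj₂; [_,_]′)
open import Data.Sum.Function.Propositional using (_⊎-↔_)
open import Data.Sum.Properties using (inj₁-injective; inj₂-injective)
open import Data.Vec using (Vec; []; _∷_; lookup; tabulate)
open import Data.Vec.Properties using (lookup∘tabulate)
open import Function using (_∘_; _⇔_; mk⇔; mk↔ₛ′; _↔_; Equivalence; Inverse; Injection)
open import Function.Definitions using (Injective)
open import Function.Properties.Inverse using (↔⇒↣)
open import Relation.Binary using (Tri; tri<; tri≈; tri>)
open import Relation.Binary.PropositionalEquality
open import Relation.Nullary using (¬_; Dec; yes; no; contradiction)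
open import Relation.Nullary.Decidable using (_×-dec_; _⊎-dec_; _→-dec_; ¬?; map′; from-yes)
open import Relation.Unary using (Decidable)

private variable
  c k m n s t : ℕ

-- Rigid matrices

DistinctColumns : EdgeColouring c s t → Set
DistinctColumns M = ∀ j j′ → (∀ i → M i j ≡ M i j′) → j ≡ j′

Preserves : EdgeColouring c s t → Permutation s s → Permutation t t → Set
Preserves M π ρ = ∀ i j → M (π ⟨$⟩ʳ i) (ρ ⟨$⟩ʳ j) ≡ M i j

Rigid : EdgeColouring c s t → Set
Rigid {s = s} {t = t} M = (π : Permutation s s) (ρ : Permutation t t) → Preserves M π ρ →
  π Perm.≈ Perm.id × ρ Perm.≈ Perm.id

HasRigid : ℕ → ℕ → ℕ → Set
HasRigid c s t = Σ (EdgeColouring c s t) Rigid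

Preserves-flip : (M : EdgeColouring c s t) (π : Permutation s s) (ρ : Permutation t t) →
  Preserves M π ρ → Preserves M (flip π) (flip ρ)
Preserves-flip M π ρ pres i j =
  trans (sym (pres (π ⟨$⟩ˡ i) (ρ ⟨$⟩ˡ j))) (cong₂ M (Perm.inverseʳ π) (Perm.inverseʳ ρ))

rigid-transpose : HasRigid c s t → HasRigid c t s
rigid-transpose (M , rigid) = (λ j i → M i j) , λ ρ π pres →
  let p , q = rigid π ρ (λ i j → pres j i) in q , p

transpose-first : (i j : Fin n) → transpose i j ⟨$⟩ʳ i ≡ j
transpose-first i j with i Fin.≟ i
... | yes _  = refl
... | no i≢i = contradiction refl i≢i

transpose-invariant : ∀ {A : Set} (f : Fin n → A) {i j} → f i ≡ f j →
  ∀ l → f (transpose i j ⟨$⟩ʳ l) ≡ f l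
transpose-invariant f {i} {j} fi≡fj l with l Fin.≟ i
... | yes l≡i = trans (sym fi≡fj) (cong f (sym l≡i))
... | no _ with l Fin.≟ j
...   | yes l≡j = trans fi≡fj (cong f (sym l≡j))
...   | no _    = refl

-- Exchanging two equal columns while fixing all rows preserves the matrix, so rigidity makes that
-- transposition trivial.
rigid⇒distinctColumns : (M : EdgeColouring c s t) → Rigid M → DistinctColumns M
rigid⇒distinctColumns M rigid j j′ eq =
  trans (sym (proj₂ (rigid Perm.id (transpose j j′)
                       (λ i → transpose-invariant (M i) (eq i))) j))
        (transpose-first j j′)

-- Columns as numbers below `c ^ s`, and complementary sets of columns

funToFin-cong : {f g : Fin m → Fin n} → (∀ i → f i ≡ g i) → funToFin f ≡ funToFin g
funToFin-cong {zero}  eq = refl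
funToFin-cong {suc m} eq = cong₂ combine (eq zero) (funToFin-cong (eq ∘ suc))

funToFin-injective : {f g : Fin m → Fin n} → funToFin f ≡ funToFin g → ∀ i → f i ≡ g i
funToFin-injective {f = f} {g} eq i =
  trans (sym (Fin.finToFun-funToFin f i))
        (trans (cong (λ z → finToFun z i) eq) (Fin.finToFun-funToFin g i))

finToFun-injective : {v w : Fin (n ^ m)} → (∀ i → finToFun {n} {m} v i ≡ finToFun w i) → v ≡ w
finToFun-injective {n} {m} {v} {w} eq =
  trans (sym (Fin.funToFin-finToFin {m} {n} v))
        (trans (funToFin-cong eq) (Fin.funToFin-finToFin {m} {n} w))

-- Serves twice: for the columns absent from a matrix, and for the patterns outside `special`.
record Complement (f : Fin m → Fin n) : Set where
  field
    size      : ℕ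
    m+size≡n  : m + size ≡ n
    enum      : Fin size → Fin n
    injective : Injective _≡_ _≡_ enum
    disjoint  : ∀ i j → f i ≢ enum j
    covers    : ∀ v → (∃[ i ] f i ≡ v) ⊎ (∃[ j ] enum j ≡ v)

complement : (f : Fin m → Fin n) → Injective _≡_ _≡_ f → Complement f
complement {zero} {n} f inj = record
  { size = n ; m+size≡n = refl ; enum = λ j → j ; injective = λ eq → eq
  ; disjoint = λ () ; covers = λ v → inj₂ (v , refl) }
complement {suc m} {zero} f inj with () ← f zero
complement {suc m} {suc n} f inj = record
  { size = C.size
  ; m+size≡n = cong suc C.m+size≡n
  ; enum = punchIn (f zero) ∘ C.enum
  ; injective = C.injective ∘ Fin.punchIn-injective (f zero) _ _
  ; disjoint = disj
  ; covers = cov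
  }
  where
  f0≢ : ∀ i → f zero ≢ f (suc i)
  f0≢ i eq with () ← inj eq

  f′ : Fin m → Fin n
  f′ i = punchOut (f0≢ i)

  module C = Complement (complement f′
    (λ eq → Fin.suc-injective (inj (Fin.punchOut-injective (f0≢ _) (f0≢ _) eq))))

  disj : ∀ i j → f i ≢ punchIn (f zero) (C.enum j)
  disj zero    j eq = Fin.punchInᵢ≢i (f zero) _ (sym eq)
  disj (suc i) j eq = C.disjoint i j
    (Fin.punchIn-injective (f zero) _ _ (trans (Fin.punchIn-punchOut (f0≢ i)) eq))

  cov : ∀ v → (∃[ i ] f i ≡ v) ⊎ (∃[ j ] punchIn (f zero) (C.enum j) ≡ v)
  cov v with f zero Fin.≟ v
  ... | yes eq = inj₁ (zero , eq)
  ... | no  ≢v with C.covers (punchOut ≢v)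
  ...   | inj₂ (j , eq) = inj₂ (j , trans (cong (punchIn (f zero)) eq) (Fin.punchIn-punchOut ≢v))
  ...   | inj₁ (i , eq) = inj₁ (suc i , Fin.punchOut-injective (f0≢ i) ≢v eq)

module _ (M : EdgeColouring c s t) (rigid : Rigid M) where

  private
    distinct = rigid⇒distinctColumns M rigid

    column : Fin t → Fin (c ^ s)
    column j = funToFin (λ i → M i j)

    module C = Complement (complement column (λ eq → distinct _ _ (funToFin-injective eq)))

    M′ : EdgeColouring c s C.size
    M′ i j = finToFun (C.enum j) i

    column≢ : ∀ j j′ → ¬ (∀ i → M′ i j′ ≡ M i j)
    column≢ j j′ eq = C.disjoint j j′
      (trans (funToFin-cong (λ i → sym (eq i))) (Fin.funToFin-finToFin {s} {c} (C.enum j′)))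

    -- Permuting the entries of a column of `M` by `π` gives a column of `M` again: were the result
    -- a column of `M′`, pulling it back along `ρ` would make the original one a column of `M′` too.
    image : ∀ π ρ → Preserves M′ π ρ → ∀ j → ∃[ j′ ] (∀ i → M (π ⟨$⟩ʳ i) j′ ≡ M i j)
    image π ρ pres j with C.covers (funToFin (λ i → M (π ⟨$⟩ˡ i) j))
    ... | inj₁ (j′ , eq) = j′ , λ i → trans (funToFin-injective eq (π ⟨$⟩ʳ i))
                                            (cong (λ z → M z j) (Perm.inverseˡ π))
    ... | inj₂ (j′ , eq) = ⊥-elim (column≢ j (ρ ⟨$⟩ˡ j′) λ i → begin
      M′ i (ρ ⟨$⟩ˡ j′)                     ≡⟨ pres i (ρ ⟨$⟩ˡ j′) ⟨
      M′ (π ⟨$⟩ʳ i) (ρ ⟨$⟩ʳ (ρ ⟨$⟩ˡ j′))   ≡⟨ cong (M′ _) (Perm.inverseʳ ρ) ⟩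
      M′ (π ⟨$⟩ʳ i) j′                     ≡⟨ cong (λ z → finToFun z (π ⟨$⟩ʳ i)) eq ⟩
      finToFun (funToFin (λ i → M (π ⟨$⟩ˡ i) j)) (π ⟨$⟩ʳ i)
                                           ≡⟨ Fin.finToFun-funToFin _ (π ⟨$⟩ʳ i) ⟩
      M (π ⟨$⟩ˡ (π ⟨$⟩ʳ i)) j              ≡⟨ cong (λ z → M z j) (Perm.inverseˡ π) ⟩
      M i j                                ∎)
      where open ≡-Reasoning

    -- A symmetry of `M′` induces one of `M` with the same `π`, so `π` is trivial; as the columns of
    -- `M′` are distinct by construction, `ρ` is trivial as well.
    rigid′ : Rigid M′
    rigid′ π ρ pres = π≈id , λ j → C.injective (finToFun-injective λ i →
      trans (cong (λ z → M′ z (ρ ⟨$⟩ʳ j)) (sym (π≈id i))) (pres i j))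
      where
      to   = image π ρ pres
      -- The inverse pair yields the inverse of `ρ₀`; the two maps cancel because the columns of `M`
      -- are distinct.
      from = image (flip π) (flip ρ) (Preserves-flip M′ π ρ pres)
      ρ₀ : Permutation t t
      ρ₀ = permutation (proj₁ ∘ to) (proj₁ ∘ from)
        (λ j → distinct _ _ λ i →
          trans (trans (cong (λ z → M z _) (sym (Perm.inverseʳ π))) (proj₂ (to _) _)) (proj₂ (from j) i))
        (λ j → distinct _ _ λ i →
          trans (trans (cong (λ z → M z _) (sym (Perm.inverseˡ π))) (proj₂ (from _) _)) (proj₂ (to j) i))
      π≈id = proj₁ (rigid π ρ₀ (λ i j → proj₂ (to j) i))

  rigid-complement′ : ∃[ t′ ] (t + t′ ≡ c ^ s × HasRigid c s t′)
  rigid-complement′ = C.size , C.m+size≡n , M′ , rigid′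

rigid-complement : ∀ {t′} → t + t′ ≡ c ^ s → HasRigid c s t → HasRigid c s t′
rigid-complement {t} {c} {s} {t′} eq (M , rigid) =
  subst (HasRigid c s) (+-cancelˡ-≡ t t″ t′ (trans eq′ (sym eq))) N
  where
  c₀ : ∃[ t″ ] (t + t″ ≡ c ^ s × HasRigid c s t″)
  c₀ = rigid-complement′ M rigid
  t″ = proj₁ c₀
  eq′ = proj₁ (proj₂ c₀)
  N = proj₂ (proj₂ c₀)

rigid⇒≤ : HasRigid c s t → t ≤ c ^ s
rigid⇒≤ {c} {s} {t} (M , rigid) = ≤-trans (m≤m+n t (proj₁ c₀)) (≤-reflexive (proj₁ (proj₂ c₀)))
  where
  c₀ : ∃[ t″ ] (t + t″ ≡ c ^ s × HasRigid c s t″)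
  c₀ = rigid-complement′ M rigid

-- Rigidity from row sums

rowSum : (Fin c → ℕ) → EdgeColouring c s t → Fin s → ℕ
rowSum δ M i = sum (λ j → δ (M i j))

-- Permuting columns leaves each row sum unchanged, so `π` carries every row to one with the same
-- sum and is the identity; then `ρ` sends each column to an equal one.
distinctRowSums⇒rigid : (δ : Fin c → ℕ) (M : EdgeColouring c s t) →
  Injective _≡_ _≡_ (rowSum δ M) → DistinctColumns M → Rigid M
distinctRowSums⇒rigid δ M inj distinct π ρ pres = π≈id , λ j → distinct _ _ λ i →
    trans (cong (λ z → M z (ρ ⟨$⟩ʳ j)) (sym (π≈id i))) (pres i j)
  where
  π≈id : π Perm.≈ Perm.id
  π≈id i = inj (trans (sum-permute (λ j → δ (M (π ⟨$⟩ʳ i) j)) ρ)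
                      (sum-cong-≗ (λ j → cong δ (pres i j))))

-- Graph automorphisms as permutations of rows and columns

identity⇒rigid : (M : EdgeColouring c s t) → IsIdentityColouring M → Rigid M
identity⇒rigid M ident π ρ pres =
  (λ i → inj₁-injective (fixes (inj₁ i))) , (λ j → inj₂-injective (fixes (inj₂ j)))
  where
  fixes = ident (π ⊎-↔ ρ) λ where
    (inj₁ i) (inj₁ i′) → refl
    (inj₁ i) (inj₂ j)  → cong just (pres i j)
    (inj₂ j) (inj₁ i)  → cong just (pres i j)
    (inj₂ j) (inj₂ j′) → refl

-- Keeping `s` and `t` separate makes `σ` itself a proof of `s ≡ t`, which rules out swaps of
-- non-square sizes.
PreservesSwapped : EdgeColouring c s t → Permutation s t → Permutation t s → Set
PreservesSwapped M σ τ = ∀ i j → M (τ ⟨$⟩ʳ j) (σ ⟨$⟩ʳ i) ≡ M i j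

⊎-swap-↔ : ∀ {A B C D : Set} → A ↔ D → B ↔ C → (A ⊎ B) ↔ (C ⊎ D)
⊎-swap-↔ f g = mk↔ₛ′
  [ inj₂ ∘ Inverse.to f , inj₁ ∘ Inverse.to g ]′
  [ inj₂ ∘ Inverse.from g , inj₁ ∘ Inverse.from f ]′
  (λ { (inj₁ x) → cong inj₁ (Inverse.inverseˡ g refl) ; (inj₂ x) → cong inj₂ (Inverse.inverseˡ f refl) })
  (λ { (inj₁ x) → cong inj₁ (Inverse.inverseʳ f refl) ; (inj₂ x) → cong inj₂ (Inverse.inverseʳ g refl) })

identity⇒¬swapped : (M : EdgeColouring c (suc s) t) → IsIdentityColouring M →
  ∀ σ τ → ¬ PreservesSwapped M σ τ
identity⇒¬swapped M ident σ τ pres = inj₂≢inj₁ (ident (⊎-swap-↔ σ τ) preserves (inj₁ zero))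
  where
  inj₂≢inj₁ : ∀ {A B : Set} {a : A} {b : B} → inj₂ b ≢ inj₁ a
  inj₂≢inj₁ ()

  preserves : IsColourAutomorphism M (⊎-swap-↔ σ τ)
  preserves (inj₁ i) (inj₁ i′) = refl
  preserves (inj₁ i) (inj₂ j)  = cong just (pres i j)
  preserves (inj₂ j) (inj₁ i)  = cong just (pres i j)
  preserves (inj₂ j) (inj₂ j′) = refl

IsInj₁ IsInj₂ : ∀ {A B : Set} → A ⊎ B → Set
IsInj₁ v = ∃[ a ] v ≡ inj₁ a
IsInj₂ v = ∃[ b ] v ≡ inj₂ b

module _ (M : EdgeColouring c (suc s) t) (φ : Vertex (suc s) t ↔ Vertex (suc s) t)
         (aut : IsColourAutomorphism M φ) where

  private
    to = Inverse.to φ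
    from = Inverse.from φ

    to∘from : ∀ v → to (from v) ≡ v
    to∘from v = Inverse.inverseˡ φ refl

    from∘to : ∀ v → from (to v) ≡ v
    from∘to v = Inverse.inverseʳ φ refl

    from-unique : ∀ {u v} → to u ≡ v → from v ≡ u
    from-unique {u} eq = trans (cong from (sym eq)) (from∘to u)

  module _ (to₁ : ∀ i → IsInj₁ (to (inj₁ i))) (to₂ : ∀ j → IsInj₂ (to (inj₂ j))) where

    private
      from₁ : ∀ i → IsInj₁ (from (inj₁ i))
      from₁ i with from (inj₁ i) in eq
      ... | inj₁ i′ = i′ , refl
      ... | inj₂ j with () ← trans (sym (proj₂ (to₂ j))) (trans (cong to (sym eq)) (to∘from _))

      from₂ : ∀ j → IsInj₂ (from (inj₂ j))
      from₂ j with from (inj₂ j) in eq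
      ... | inj₂ j′ = j′ , refl
      ... | inj₁ i with () ← trans (sym (proj₂ (to₁ i))) (trans (cong to (sym eq)) (to∘from _))

    fixes-of-rigid : Rigid M → ∀ v → to v ≡ v
    fixes-of-rigid rigid = λ where
        (inj₁ i) → trans (proj₂ (to₁ i)) (cong inj₁ (proj₁ fix i))
        (inj₂ j) → trans (proj₂ (to₂ j)) (cong inj₂ (proj₂ fix j))
      where
      π = permutation (proj₁ ∘ to₁) (proj₁ ∘ from₁)
        (λ i → inj₁-injective (trans (sym (proj₂ (to₁ _))) (trans (cong to (sym (proj₂ (from₁ i)))) (to∘from _))))
        (λ i → inj₁-injective (trans (sym (proj₂ (from₁ _))) (from-unique (proj₂ (to₁ i)))))
      ρ = permutation (proj₁ ∘ to₂) (proj₁ ∘ from₂)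
        (λ j → inj₂-injective (trans (sym (proj₂ (to₂ _))) (trans (cong to (sym (proj₂ (from₂ j)))) (to∘from _))))
        (λ j → inj₂-injective (trans (sym (proj₂ (from₂ _))) (from-unique (proj₂ (to₂ j)))))
      fix = rigid π ρ (λ i j → just-injective
        (trans (sym (cong₂ (edgeCol M) (proj₂ (to₁ i)) (proj₂ (to₂ j)))) (aut (inj₁ i) (inj₂ j))))

  module _ (to₁ : ∀ i → IsInj₂ (to (inj₁ i))) (to₂ : ∀ j → IsInj₁ (to (inj₂ j))) where

    private
      from₁ : ∀ i → IsInj₂ (from (inj₁ i))
      from₁ i with from (inj₁ i) in eq
      ... | inj₂ j = j , refl
      ... | inj₁ i′ with () ← trans (sym (proj₂ (to₁ i′))) (trans (cong to (sym eq)) (to∘from _))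

      from₂ : ∀ j → IsInj₁ (from (inj₂ j))
      from₂ j with from (inj₂ j) in eq
      ... | inj₁ i = i , refl
      ... | inj₂ j′ with () ← trans (sym (proj₂ (to₂ j′))) (trans (cong to (sym eq)) (to∘from _))

    swapped : ∃[ σ ] ∃[ τ ] PreservesSwapped M σ τ
    swapped =
      permutation (proj₁ ∘ to₁) (proj₁ ∘ from₂)
        (λ j → inj₂-injective (trans (sym (proj₂ (to₁ _))) (trans (cong to (sym (proj₂ (from₂ j)))) (to∘from _))))
        (λ i → inj₁-injective (trans (sym (proj₂ (from₂ _))) (from-unique (proj₂ (to₁ i))))) ,
      permutation (proj₁ ∘ to₂) (proj₁ ∘ from₁)
        (λ i → inj₁-injective (trans (sym (proj₂ (to₂ _))) (trans (cong to (sym (proj₂ (from₁ i)))) (to∘from _))))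
        (λ j → inj₂-injective (trans (sym (proj₂ (from₁ _))) (from-unique (proj₂ (to₂ j))))) ,
      λ i j → just-injective
        (trans (sym (cong₂ (edgeCol M) (proj₂ (to₁ i)) (proj₂ (to₂ j)))) (aut (inj₁ i) (inj₂ j)))

  -- Two vertices lie in the same part exactly when `edgeCol` gives `nothing`, and automorphisms
  -- preserve this. So the part containing the image of row `zero` determines the part of every
  -- other image.
  fixes-or-swaps : Rigid M → (∀ v → to v ≡ v) ⊎ (∃[ σ ] ∃[ τ ] PreservesSwapped M σ τ)
  fixes-or-swaps rigid with to (inj₁ zero) in eq₀
  ... | inj₁ i₀ = inj₁ (fixes-of-rigid to₁ to₂ rigid)
    where
    to₁ : ∀ i → IsInj₁ (to (inj₁ i))
    to₁ i with to (inj₁ i) in eq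
    ... | inj₁ i′ = i′ , refl
    ... | inj₂ j with () ← trans (sym (cong₂ (edgeCol M) eq₀ eq)) (aut (inj₁ zero) (inj₁ i))
    to₂ : ∀ j → IsInj₂ (to (inj₂ j))
    to₂ j with to (inj₂ j) in eq
    ... | inj₂ j′ = j′ , refl
    ... | inj₁ i with () ← trans (sym (cong₂ (edgeCol M) eq₀ eq)) (aut (inj₁ zero) (inj₂ j))
  ... | inj₂ j₀ = inj₂ (swapped to₁ to₂)
    where
    to₁ : ∀ i → IsInj₂ (to (inj₁ i))
    to₁ i with to (inj₁ i) in eq
    ... | inj₂ j = j , refl
    ... | inj₁ i′ with () ← trans (sym (cong₂ (edgeCol M) eq₀ eq)) (aut (inj₁ zero) (inj₁ i))
    to₂ : ∀ j → IsInj₁ (to (inj₂ j))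
    to₂ j with to (inj₂ j) in eq
    ... | inj₁ i = i , refl
    ... | inj₂ j′ with () ← trans (sym (cong₂ (edgeCol M) eq₀ eq)) (aut (inj₁ zero) (inj₂ j))

rigid⇒identity : (M : EdgeColouring c (suc s) t) → Rigid M →
  (∀ σ τ → ¬ PreservesSwapped M σ τ) → IsIdentityColouring M
rigid⇒identity M rigid ¬swap φ aut with fixes-or-swaps M φ aut rigid
... | inj₁ fixes            = fixes
... | inj₂ (σ , τ , swaps)  = ⊥-elim (¬swap σ τ swaps)

rigid⇒hasIdentity : suc s ≢ t → HasRigid c (suc s) t → HasIdentityColouring c (suc s) t
rigid⇒hasIdentity s≢t (M , rigid) = M , rigid⇒identity M rigid
  (λ σ _ _ → s≢t (Perm.↔⇒≡ σ))

hasIdentity⇒rigid : HasIdentityColouring c s t → HasRigid c s t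
hasIdentity⇒rigid (M , ident) = M , identity⇒rigid M ident

-- Two colours, sizes 2 and 3: exhaustive search

allVec? : ∀ n {P : Vec (Fin 2) n → Set} → Decidable P → Dec (∀ v → P v)
allVec? zero    P? = map′ (λ { p [] → p }) (λ f → f []) (P? [])
allVec? (suc n) P? =
  map′ (λ { (p₀ , p₁) (0F ∷ v) → p₀ v ; (p₀ , p₁) (1F ∷ v) → p₁ v })
       (λ f → f ∘ (0F ∷_) , f ∘ (1F ∷_))
       (allVec? n (P? ∘ (0F ∷_)) ×-dec allVec? n (P? ∘ (1F ∷_)))

-- Only candidates from the given lists are tried, and swaps only with `τ` inverse to `σ`. Such a
-- swap says that the matrix becomes symmetric once its columns are permuted by `σ`. For both sizes
-- searched these candidates suffice.
Symmetric : (πs σs : List (Permutation n n)) → EdgeColouring c n n → Set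
Symmetric πs σs M =
  Any (λ (π , ρ) → ¬ (π Perm.≈ Perm.id × ρ Perm.≈ Perm.id) × Preserves M π ρ)
      (cartesianProduct πs πs)
  ⊎ Any (λ σ → PreservesSwapped M σ (flip σ)) σs

symmetric? : (πs σs : List (Permutation n n)) → Decidable (Symmetric {c = c} πs σs)
symmetric? πs σs M =
  any? (λ (π , ρ) → ¬? (Fin.all? (λ i → _ Fin.≟ _) ×-dec Fin.all? (λ i → _ Fin.≟ _))
                    ×-dec Fin.all? (λ i → Fin.all? (λ j → _ Fin.≟ _))) _
  ⊎-dec any? (λ σ → Fin.all? (λ i → Fin.all? (λ j → _ Fin.≟ _))) σs

symmetric-resp : ∀ πs σs {M M′ : EdgeColouring c n n} → (∀ i j → M i j ≡ M′ i j) →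
  Symmetric πs σs M → Symmetric πs σs M′
symmetric-resp πs σs eq = Sum.map
  (Any.map (map₂ λ pres i j → trans (sym (eq _ _)) (trans (pres i j) (eq i j))))
  (Any.map λ pres i j → trans (sym (eq _ _)) (trans (pres i j) (eq i j)))

symmetric⇒¬identity : ∀ πs σs {M : EdgeColouring c (suc n) (suc n)} →
  Symmetric πs σs M → ¬ IsIdentityColouring M
symmetric⇒¬identity πs σs {M} (inj₁ sym′) ident with Any.satisfied sym′
... | (π , ρ) , ≉id , pres = ≉id (identity⇒rigid M ident π ρ pres)
symmetric⇒¬identity πs σs {M} (inj₂ sym′) ident with Any.satisfied sym′
... | σ , pres = identity⇒¬swapped M ident σ (flip σ) pres

-- Vectors can be enumerated up to equality, while colourings as functions are compared only
-- pointwise; `symmetric-resp` bridges the difference.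
fromTable : ∀ n → Vec (Fin 2) (n * n) → EdgeColouring 2 n n
fromTable n v i j = lookup v (combine i j)

toTable : ∀ n → EdgeColouring 2 n n → Vec (Fin 2) (n * n)
toTable n M = tabulate (uncurry M ∘ remQuot n)

fromTable-toTable : ∀ n M i j → fromTable n (toTable n M) i j ≡ M i j
fromTable-toTable n M i j =
  trans (lookup∘tabulate _ (combine i j)) (cong (uncurry M) (Fin.remQuot-combine i j))

allSymmetric⇒¬hasIdentity : ∀ πs σs → (∀ v → Symmetric πs σs (fromTable (suc n) v)) →
  ¬ HasIdentityColouring 2 (suc n) (suc n)
allSymmetric⇒¬hasIdentity {n} πs σs all (M , ident) = symmetric⇒¬identity πs σs
  (symmetric-resp πs σs (fromTable-toTable (suc n) M) (all (toTable (suc n) M))) ident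

¬hasIdentity₂₂ : ¬ HasIdentityColouring 2 2 2
¬hasIdentity₂₂ = allSymmetric⇒¬hasIdentity πs πs
  (from-yes (allVec? 4 λ v → symmetric? πs πs (fromTable 2 v)))
  where πs = Perm.id ∷ transpose 0F 1F ∷ []

¬hasIdentity₃₃ : ¬ HasIdentityColouring 2 3 3
¬hasIdentity₃₃ = allSymmetric⇒¬hasIdentity πs σs
  (from-yes (allVec? 9 λ v → symmetric? πs σs (fromTable 3 v)))
  where
  πs = Perm.id ∷ transpose 0F 1F ∷ transpose 0F 2F ∷ transpose 1F 2F ∷ []
  -- The two products are the 3-cycles, so all six permutations are available for swaps; for rows
  -- and columns the identity and the transpositions are enough.
  σs = transpose 0F 1F ∘ₚ transpose 0F 2F ∷ transpose 0F 2F ∘ₚ transpose 0F 1F ∷ πs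

-- Finite sums and addition of colours modulo `c`

sum-split : ∀ m {n} (f : Fin (m + n) → ℕ) → sum f ≡ sum (f ∘ (_↑ˡ n)) + sum (f ∘ (m ↑ʳ_))
sum-split zero    f = refl
sum-split (suc m) f =
  trans (cong (f zero +_) (sum-split m (f ∘ suc))) (sym (+-assoc (f zero) _ _))

sum-combine : ∀ m {n} (f : Fin (m * n) → ℕ) → sum f ≡ sum {m} (λ i → sum {n} (λ j → f (combine i j)))
sum-combine zero        f = refl
sum-combine (suc m) {n} f = trans (sum-split n f) (cong (sum (f ∘ (_↑ˡ (m * n))) +_) (sum-combine m (f ∘ (n ↑ʳ_))))

_⊕_ : Fin (suc n) → Fin (suc n) → Fin (suc n)
_⊕_ {n} a b = (toℕ a + toℕ b) mod suc n

toℕ-⊕ : (a b : Fin (suc n)) → toℕ (a ⊕ b) ≡ (toℕ a + toℕ b) % suc n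
toℕ-⊕ a b = Fin.toℕ-fromℕ< _

%-cancel-complement : ∀ p q x n → p + q ≡ suc n → (p + (q + x) % suc n) % suc n ≡ x % suc n
%-cancel-complement p q x n p+q≡ = begin
  (p + (q + x) % suc n) % suc n                      ≡⟨ %-distribˡ-+ p _ (suc n) ⟩
  (p % suc n + (q + x) % suc n % suc n) % suc n      ≡⟨ cong (λ z → (p % suc n + z) % suc n) (m%n%n≡m%n (q + x) (suc n)) ⟩
  (p % suc n + (q + x) % suc n) % suc n              ≡⟨ %-distribˡ-+ p (q + x) (suc n) ⟨
  (p + (q + x)) % suc n                              ≡⟨ cong (_% suc n) (trans (sym (+-assoc p q x)) (cong (_+ x) p+q≡)) ⟩
  (suc n + x) % suc n                                ≡⟨ cong (_% suc n) (+-comm (suc n) x) ⟩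
  (x + suc n) % suc n                                ≡⟨ [m+n]%n≡m%n x (suc n) ⟩
  x % suc n                                          ∎
  where open ≡-Reasoning

toℕ%n : (x : Fin (suc n)) → toℕ x % suc n ≡ toℕ x
toℕ%n x = m<n⇒m%n≡m (Fin.toℕ<n x)

-- The amount is a natural number, not a residue: `suc n ∸ toℕ a`, the amount of the inverse shift,
-- is the full modulus when `a` is `zero`.
shift : ∀ n → ℕ → Fin (suc n) → Fin (suc n)
shift n p x = (p + toℕ x) mod suc n

shift-inverse : ∀ n p q → p + q ≡ suc n → ∀ x → shift n p (shift n q x) ≡ x
shift-inverse n p q p+q≡ x = Fin.toℕ-injective (begin
  toℕ (shift n p (shift n q x))              ≡⟨ Fin.toℕ-fromℕ< _ ⟩
  (p + toℕ (shift n q x)) % suc n            ≡⟨ cong (λ z → (p + z) % suc n) (Fin.toℕ-fromℕ< _) ⟩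
  (p + (q + toℕ x) % suc n) % suc n          ≡⟨ %-cancel-complement p q (toℕ x) n p+q≡ ⟩
  toℕ x % suc n                              ≡⟨ toℕ%n x ⟩
  toℕ x                                      ∎)
  where open ≡-Reasoning

a+[n∸a]≡n : (a : Fin (suc n)) → toℕ a + (suc n ∸ toℕ a) ≡ suc n
a+[n∸a]≡n a = m+[n∸m]≡n (<⇒≤ (Fin.toℕ<n a))

shift-permutation : Fin (suc n) → Permutation (suc n) (suc n)
shift-permutation {n} a = permutation (shift n (toℕ a)) (shift n (suc n ∸ toℕ a))
  (shift-inverse n (toℕ a) (suc n ∸ toℕ a) (a+[n∸a]≡n a))
  (shift-inverse n (suc n ∸ toℕ a) (toℕ a) (trans (+-comm _ (toℕ a)) (a+[n∸a]≡n a)))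

⊕-cancelˡ : (a : Fin (suc n)) {b b′ : Fin (suc n)} → a ⊕ b ≡ a ⊕ b′ → b ≡ b′
⊕-cancelˡ a {b} {b′} eq = begin
  b                                                      ≡⟨ Perm.inverseˡ (shift-permutation a) ⟨
  shift-permutation a ⟨$⟩ˡ (a ⊕ b)                       ≡⟨ cong (shift-permutation a ⟨$⟩ˡ_) eq ⟩
  shift-permutation a ⟨$⟩ˡ (a ⊕ b′)                      ≡⟨ Perm.inverseˡ (shift-permutation a) ⟩
  b′                                                     ∎
  where open ≡-Reasoning

⊕-comm : (a b : Fin (suc n)) → a ⊕ b ≡ b ⊕ a
⊕-comm {n} a b = cong (λ z → z mod suc n) (+-comm (toℕ a) (toℕ b))

⊕-identityʳ : (a : Fin (suc n)) → a ⊕ zero ≡ a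
⊕-identityʳ {n} a = Fin.toℕ-injective (trans (toℕ-⊕ a zero)
  (trans (cong (_% suc n) (+-identityʳ (toℕ a))) (toℕ%n a)))

-- Adding `b` permutes the colours. Hence an orbit of columns contributes equally to every row.
sum-⊕ : (f : Fin (suc n) → ℕ) (b : Fin (suc n)) → sum (λ a → f (a ⊕ b)) ≡ sum f
sum-⊕ f b = trans (sum-cong-≗ (λ a → cong f (⊕-comm a b))) (sym (sum-permute f (shift-permutation b)))

-- Staircase patterns

staircase : Fin n → Fin n → Fin (suc (suc k))
staircase zero    r       = 1F
staircase (suc i) zero    = 0F
staircase (suc i) (suc r) = staircase i r

staircase-diagonal : (i : Fin n) → staircase {k = k} i i ≡ 1F
staircase-diagonal zero    = refl
staircase-diagonal (suc i) = staircase-diagonal i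

staircase-injective : (i i′ : Fin n) → (∀ r → staircase {k = k} i r ≡ staircase i′ r) → i ≡ i′
staircase-injective zero    zero     eq = refl
staircase-injective zero    (suc i′) eq with () ← eq zero
staircase-injective (suc i) zero     eq with () ← eq zero
staircase-injective (suc i) (suc i′) eq = cong suc (staircase-injective i i′ (eq ∘ suc))

isOne : Fin (suc (suc k)) → ℕ
isOne 1F = 1
isOne _  = 0

-- The entry `staircase i r` is `1F` exactly when `i ≤ r`, so the sum counts the columns from 0 to
-- `r`.
sum-staircase : (r : Fin n) → sum (λ i → isOne {k} (staircase i r)) ≡ suc (toℕ r)
sum-staircase {n = suc n} zero = cong suc (sum-replicate-zero n)
sum-staircase {n = suc n} (suc r) = cong suc (sum-staircase r)

-- Rigid matrices from a staircase, whole orbits and constant columns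

module Construction (k n : ℕ) where

  private
    κ : ℕ
    κ = suc (suc k)

    Pattern : Set
    Pattern = Fin (κ ^ n)

  -- Column (w , a) is a followed by the entries of w shifted by a; for fixed w, the
  -- columns (w , a) form an orbit, in which every row meets each colour exactly once.
  column : Pattern × Fin κ → Fin (suc n) → Fin κ
  column (w , a) zero    = a
  column (w , a) (suc r) = a ⊕ finToFun w r

  column-injective : ∀ {p q} → (∀ i → column p i ≡ column q i) → p ≡ q
  column-injective {w , a} {w′ , a′} eq with refl ← eq zero =
    cong (_, a) (finToFun-injective {κ} {n} (λ r → ⊕-cancelˡ a (eq (suc r))))

  -- The patterns of the constant columns and of the staircase; only the orbits of the
  -- remaining, generic, patterns are added as a whole.
  special : Fin (suc n) → Pattern
  special zero    = funToFin {n} {κ} (λ _ → zero)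
  special (suc i) = funToFin (staircase i)

  special-injective : Injective _≡_ _≡_ special
  special-injective {zero}  {zero}   eq = refl
  special-injective {zero}  {suc i}  eq = contradiction
    (trans (funToFin-injective {g = staircase i} eq i) (staircase-diagonal {k = k} i)) Fin.0≢1+n
  special-injective {suc i} {zero}   eq = contradiction
    (trans (sym (funToFin-injective {f = staircase i} eq i)) (staircase-diagonal {k = k} i)) Fin.0≢1+n
  special-injective {suc i} {suc i′} eq = cong suc (staircase-injective {k = k} i i′ (funToFin-injective eq))

  private module Generic = Complement (complement special special-injective)

  module _ (q e : ℕ) (q≤ : q ≤ Generic.size) (e≤κ : e ≤ κ) where

    -- The summands stand for `n` staircase columns with top entry `zero`, `q` whole orbits of `κ`
    -- columns, and `e` constant columns. Each block contributes to the row sums separately.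
    Label : Set
    Label = Fin n ⊎ (Fin (q * κ) ⊎ Fin e)

    generic : Fin q → Pattern
    generic i = Generic.enum (inject≤ i q≤)

    label : Label → Pattern × Fin κ
    label (inj₁ i)        = special (suc i) , zero
    label (inj₂ (inj₁ j)) = let i , a = remQuot {q} κ j in generic i , a
    label (inj₂ (inj₂ a)) = special zero , inject≤ a e≤κ

    label-injective : Injective _≡_ _≡_ label
    label-injective {inj₁ i} {inj₁ i′} eq =
      cong inj₁ (Fin.suc-injective (special-injective (cong proj₁ eq)))
    label-injective {inj₁ i} {inj₂ (inj₁ j)} eq = contradiction (cong proj₁ eq) (Generic.disjoint (suc i) _)
    label-injective {inj₁ i} {inj₂ (inj₂ a)} eq
      with () ← special-injective {suc i} {zero} (cong proj₁ eq)
    label-injective {inj₂ (inj₁ j)} {inj₁ i} eq = contradiction (sym (cong proj₁ eq)) (Generic.disjoint (suc i) _)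
    label-injective {inj₂ (inj₁ j)} {inj₂ (inj₁ j′)} eq = cong (inj₂ ∘ inj₁) (begin
      j                                   ≡⟨ Fin.combine-remQuot {q} κ j ⟨
      uncurry combine (remQuot {q} κ j)   ≡⟨ cong₂ combine
                                               (Fin.inject≤-injective q≤ q≤ _ _ (Generic.injective (cong proj₁ eq)))
                                               (cong proj₂ eq) ⟩
      uncurry combine (remQuot {q} κ j′)  ≡⟨ Fin.combine-remQuot {q} κ j′ ⟩
      j′                                  ∎)
      where open ≡-Reasoning
    label-injective {inj₂ (inj₁ j)} {inj₂ (inj₂ a)} eq = contradiction (sym (cong proj₁ eq)) (Generic.disjoint zero _)
    label-injective {inj₂ (inj₂ a)} {inj₁ i} eq
      with () ← special-injective {zero} {suc i} (cong proj₁ eq)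
    label-injective {inj₂ (inj₂ a)} {inj₂ (inj₁ j)} eq = contradiction (cong proj₁ eq) (Generic.disjoint zero _)
    label-injective {inj₂ (inj₂ a)} {inj₂ (inj₂ a′)} eq =
      cong (inj₂ ∘ inj₂) (Fin.inject≤-injective e≤κ e≤κ _ _ (cong proj₂ eq))

    index : Fin (n + (q * κ + e)) → Label
    index j = [ inj₁ , inj₂ ∘ splitAt (q * κ) ]′ (splitAt n j)

    index-injective : Injective _≡_ _≡_ index
    index-injective {j} {j′} eq with splitAt n j in eqⱼ | splitAt n j′ in eqⱼ′
    index-injective {j} {j′} refl | inj₁ i | inj₁ .i =
      trans (sym (Fin.splitAt⁻¹-↑ˡ eqⱼ)) (Fin.splitAt⁻¹-↑ˡ eqⱼ′)
    ... | inj₂ i | inj₂ i′ with splitAt (q * κ) i in eqᵢ | splitAt (q * κ) i′ in eqᵢ′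
    index-injective {j} {j′} refl | inj₂ i | inj₂ i′ | inj₁ l | inj₁ .l =
      trans (sym (Fin.splitAt⁻¹-↑ʳ eqⱼ))
        (trans (cong (n ↑ʳ_) (trans (sym (Fin.splitAt⁻¹-↑ˡ eqᵢ)) (Fin.splitAt⁻¹-↑ˡ eqᵢ′)))
          (Fin.splitAt⁻¹-↑ʳ eqⱼ′))
    index-injective {j} {j′} refl | inj₂ i | inj₂ i′ | inj₂ l | inj₂ .l =
      trans (sym (Fin.splitAt⁻¹-↑ʳ eqⱼ))
        (trans (cong (n ↑ʳ_) (trans (sym (Fin.splitAt⁻¹-↑ʳ {q * κ} eqᵢ)) (Fin.splitAt⁻¹-↑ʳ {q * κ} eqᵢ′)))
          (Fin.splitAt⁻¹-↑ʳ eqⱼ′))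

    matrix : EdgeColouring κ (suc n) (n + (q * κ + e))
    matrix i j = column (label (index j)) i

    private
      weight : Fin (suc n) → Label → ℕ
      weight i l = isOne (column (label l) i)

      sum-index : (f : Label → ℕ) → sum (f ∘ index) ≡
        sum (f ∘ inj₁) + (sum (f ∘ inj₂ ∘ inj₁) + sum (f ∘ inj₂ ∘ inj₂))
      sum-index f = trans (sum-split n (f ∘ index)) (cong₂ _+_
        (sum-cong-≗ λ i → cong (f ∘ [ inj₁ , inj₂ ∘ splitAt (q * κ) ]′) (Fin.splitAt-↑ˡ n i _))
        (trans (sum-cong-≗ λ i → cong (f ∘ [ inj₁ , inj₂ ∘ splitAt (q * κ) ]′) (Fin.splitAt-↑ʳ n _ i))
          (trans (sum-split (q * κ) (f ∘ inj₂ ∘ splitAt (q * κ))) (cong₂ _+_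
            (sum-cong-≗ λ j → cong (f ∘ inj₂) (Fin.splitAt-↑ˡ (q * κ) j _))
            (sum-cong-≗ λ j → cong (f ∘ inj₂) (Fin.splitAt-↑ʳ (q * κ) _ j))))))

      sum-special : ∀ i → sum (weight i ∘ inj₁) ≡ toℕ i
      sum-special zero    = sum-replicate-zero n
      sum-special (suc r) = trans
        (sum-cong-≗ λ i → cong isOne (trans (⊕-comm zero (finToFun (special (suc i)) r))
          (trans (⊕-identityʳ (finToFun (special (suc i)) r)) (Fin.finToFun-funToFin (staircase i) r))))
        (sum-staircase {k = k} r)

      sum-generic : ∀ i → sum (weight i ∘ inj₂ ∘ inj₁) ≡ sum {q} (λ _ → sum (isOne {k}))
      sum-generic i = trans (sum-combine q (weight i ∘ inj₂ ∘ inj₁))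
        (sum-cong-≗ λ l → trans (sum-cong-≗ λ a →
            cong (λ (l , a) → isOne (column (generic l , a) i)) (Fin.remQuot-combine l a))
          (orbit l i))
        where
        orbit : ∀ l i → sum (λ a → isOne (column (generic l , a) i)) ≡ sum (isOne {k})
        orbit l zero    = refl
        orbit l (suc r) = sum-⊕ isOne (finToFun (generic l) r)

      sum-constant : ∀ i → sum (weight i ∘ inj₂ ∘ inj₂) ≡ sum {e} (λ a → isOne (inject≤ a e≤κ))
      sum-constant zero    = refl
      sum-constant (suc r) = sum-cong-≗ λ a → cong isOne (trans
        (cong (inject≤ a e≤κ ⊕_) (Fin.finToFun-funToFin {n} {κ} (λ _ → zero) r))
        (⊕-identityʳ (inject≤ a e≤κ)))

    -- The staircase puts `toℕ i` ones into row `i`, and the other two blocks add an amount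
    -- independent of `i`; so the row sums are distinct.
    matrix-rigid : Rigid matrix
    matrix-rigid = distinctRowSums⇒rigid isOne matrix
      (λ {i} {i′} eq → Fin.toℕ-injective (+-cancelʳ-≡ _ (toℕ i) (toℕ i′)
        (trans (sym (total i)) (trans eq (total i′)))))
      (λ j j′ eq → index-injective (label-injective (column-injective eq)))
      where
      total : ∀ i → rowSum isOne matrix i ≡
        toℕ i + (sum {q} (λ _ → sum (isOne {k})) + sum {e} (λ a → isOne (inject≤ a e≤κ)))
      total i = trans (sum-index (weight i))
        (cong₂ _+_ (sum-special i) (cong₂ _+_ (sum-generic i) (sum-constant i)))

  -- Here `p` counts the generic patterns: all `κ ^ n` patterns except the zero pattern and the `n`
  -- staircase ones.
  hasRigid : ∀ {q e p} → suc n + p ≡ κ ^ n → q ≤ p → e ≤ κ → HasRigid κ (suc n) (n + (q * κ + e))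
  hasRigid {q} {e} {p} eq q≤p e≤κ = matrix q e q≤ e≤κ , matrix-rigid q e q≤ e≤κ
    where
    q≤ : q ≤ Generic.size
    q≤ = ≤-trans q≤p (≤-reflexive (+-cancelˡ-≡ (suc n) p Generic.size (trans eq (sym Generic.m+size≡n))))

-- Square identity colourings

-- The first column is entirely of colour 2, but no row is, so the parts cannot be
-- interchanged (unless there is only one row).
squareMatrix : ∀ k n → EdgeColouring (3 + k) (suc n) (suc n)
squareMatrix k n i       zero    = 2F
squareMatrix k n zero    (suc j) = 0F
squareMatrix k n (suc i) (suc j) = staircase j i

staircase≢2 : (i r : Fin n) → staircase {k = suc k} i r ≢ 2F
staircase≢2 zero    r       ()
staircase≢2 (suc i) zero    ()
staircase≢2 (suc i) (suc r) eq = staircase≢2 i r eq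

squareMatrix≡2⇒zero : ∀ (i j : Fin (suc n)) → squareMatrix k n i j ≡ 2F → j ≡ zero
squareMatrix≡2⇒zero i       zero    eq = refl
squareMatrix≡2⇒zero zero    (suc j) ()
squareMatrix≡2⇒zero (suc i) (suc j) eq = contradiction eq (staircase≢2 j i)

-- Under a swap, `σ` would send every row to the only column containing `2F`; the size `2 + n`
-- provides two rows, which contradicts injectivity.
hasIdentity-square≥3 : ∀ k n → HasIdentityColouring (3 + k) (2 + n) (2 + n)
hasIdentity-square≥3 k n = M , rigid⇒identity M rigid λ σ τ pres →
  Fin.0≢1+n (Injection.injective (↔⇒↣ σ) (trans (column0 σ τ pres 0F) (sym (column0 σ τ pres 1F))))
  where
  M = squareMatrix k (suc n)

  column0 : ∀ σ τ → PreservesSwapped M σ τ → ∀ i → σ ⟨$⟩ʳ i ≡ zero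
  column0 σ τ pres i = squareMatrix≡2⇒zero (τ ⟨$⟩ʳ 0F) (σ ⟨$⟩ʳ i) (pres i zero)

  distinct : DistinctColumns M
  distinct zero    zero     eq = refl
  distinct zero    (suc j′) eq with () ← squareMatrix≡2⇒zero zero (suc j′) (sym (eq zero))
  distinct (suc j) zero     eq with () ← squareMatrix≡2⇒zero zero (suc j) (eq zero)
  distinct (suc j) (suc j′) eq = cong suc (staircase-injective j j′ (eq ∘ suc))

  total : ∀ i → rowSum isOne M i ≡ toℕ i
  total zero    = sum-replicate-zero (suc n)
  total (suc r) = sum-staircase {k = suc k} r

  rigid : Rigid M
  rigid = distinctRowSums⇒rigid isOne M
    (λ {i} {i′} eq → Fin.toℕ-injective (trans (sym (total i)) (trans eq (total i′)))) distinct

columnSum : (Fin c → ℕ) → EdgeColouring c s t → Fin t → ℕ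
columnSum δ M j = sum (λ i → δ (M i j))

-- Interchanging the parts would turn the column sums into row sums.
¬swapped : (δ : Fin c → ℕ) (M : EdgeColouring c s t) → Injective _≡_ _≡_ (rowSum δ M) →
  ∀ {j j′} → j ≢ j′ → columnSum δ M j ≡ columnSum δ M j′ → ∀ σ τ → ¬ PreservesSwapped M σ τ
¬swapped δ M inj j≢j′ eq σ τ pres =
  j≢j′ (Injection.injective (↔⇒↣ τ) (inj (trans (row _) (trans eq (sym (row _))))))
  where
  row : ∀ j → rowSum δ M (τ ⟨$⟩ʳ j) ≡ columnSum δ M j
  row j = trans (sum-permute (λ i → δ (M (τ ⟨$⟩ʳ j) i)) σ) (sum-cong-≗ (λ i → cong δ (pres i j)))

-- The 4 × 4 matrix has row sums 3, 2, 1, 0 and column sums 2, 2, 1, 1; each step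
-- adds a first column of zeros and completes the new first row with ones.
binaryMatrix : ∀ n → EdgeColouring 2 (4 + n) (4 + n)
binaryMatrix zero 0F 0F = 1F
binaryMatrix zero 0F 1F = 1F
binaryMatrix zero 0F 2F = 1F
binaryMatrix zero 1F 0F = 1F
binaryMatrix zero 1F 3F = 1F
binaryMatrix zero 2F 1F = 1F
binaryMatrix zero _  _  = 0F
binaryMatrix (suc n) i       zero    = 0F
binaryMatrix (suc n) zero    (suc j) = 1F
binaryMatrix (suc n) (suc i) (suc j) = binaryMatrix n i j

rowTotal : ∀ n → Fin (4 + n) → ℕ
rowTotal n = rowSum isOne (binaryMatrix n)

sum-ones : ∀ m → sum {m} (λ _ → 1) ≡ m
sum-ones zero    = refl
sum-ones (suc m) = cong suc (sum-ones m)

rowTotal-zero : ∀ n → rowTotal (suc n) zero ≡ 4 + n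
rowTotal-zero n = sum-ones (4 + n)

-- Separates the new first row, of sum `4 + n`, from the rows of the preceding matrix in the
-- induction for `rowTotal-injective`.
rowTotal< : ∀ n i → rowTotal n i < 4 + n
rowTotal< zero    = from-yes (Fin.all? λ i → rowTotal 0 i <? 4)
rowTotal< (suc n) zero    = s≤s (≤-reflexive (rowTotal-zero n))
rowTotal< (suc n) (suc i) = m<n⇒m<1+n (rowTotal< n i)

rowTotal-injective : ∀ n i i′ → rowTotal n i ≡ rowTotal n i′ → i ≡ i′
rowTotal-injective zero = from-yes (Fin.all? λ i → Fin.all? λ i′ →
  (rowTotal 0 i ≟ rowTotal 0 i′) →-dec (i Fin.≟ i′))
rowTotal-injective (suc n) zero    zero     eq = refl
rowTotal-injective (suc n) zero    (suc i′) eq =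
  contradiction (trans (sym eq) (rowTotal-zero n)) (<⇒≢ (rowTotal< n i′))
rowTotal-injective (suc n) (suc i) zero     eq =
  contradiction (trans eq (rowTotal-zero n)) (<⇒≢ (rowTotal< n i))
rowTotal-injective (suc n) (suc i) (suc i′) eq = cong suc (rowTotal-injective n i i′ eq)

binaryMatrix-distinct : ∀ n → DistinctColumns (binaryMatrix n)
binaryMatrix-distinct zero = from-yes (Fin.all? λ j → Fin.all? λ j′ →
  Fin.all? (λ i → binaryMatrix 0 i j Fin.≟ binaryMatrix 0 i j′) →-dec (j Fin.≟ j′))
binaryMatrix-distinct (suc n) zero    zero     eq = refl
binaryMatrix-distinct (suc n) zero    (suc j′) eq with () ← eq zero
binaryMatrix-distinct (suc n) (suc j) zero     eq with () ← eq zero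
binaryMatrix-distinct (suc n) (suc j) (suc j′) eq =
  cong suc (binaryMatrix-distinct n j j′ (eq ∘ suc))

-- The pair found in the 4 × 4 matrix persists, since each step adds a single one, in the new first
-- row, to both columns.
equalColumnSums : ∀ n → ∃₂ λ j j′ → j ≢ j′ ×
  columnSum isOne (binaryMatrix n) j ≡ columnSum isOne (binaryMatrix n) j′
equalColumnSums zero    = 0F , 1F , (λ ()) , refl
equalColumnSums (suc n) with equalColumnSums n
... | j , j′ , j≢j′ , eq = suc j , suc j′ , j≢j′ ∘ Fin.suc-injective , cong suc eq

hasIdentity-square₂ : ∀ n → HasIdentityColouring 2 (4 + n) (4 + n)
hasIdentity-square₂ n with equalColumnSums n
... | j , j′ , j≢j′ , eq = M , rigid⇒identity M
  (distinctRowSums⇒rigid isOne M inj (binaryMatrix-distinct n))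
  (¬swapped isOne M inj j≢j′ eq)
  where
  M = binaryMatrix n
  inj : Injective _≡_ _≡_ (rowSum isOne M)
  inj {i} {i′} = rowTotal-injective n i i′

-- The sizes reached by the construction, complements and transposes

quotient-split : ∀ c p d → d ≤ c * suc p → ∃₂ λ q e → q ≤ p × e ≤ c × d ≡ q * c + e
quotient-split c p d d≤ with d ≤? c
-- The remainder may equal `c`, as there are `c` constant columns; this is how `d = c * suc p` is
-- reached with `q = p`.
... | yes d≤c = 0 , d , z≤n , d≤c , refl
quotient-split c zero    d d≤ | no d≰c = contradiction (≤-trans d≤ (≤-reflexive (*-identityʳ c))) d≰c
quotient-split c (suc p) d d≤ | no d≰c
  with quotient-split c p (d ∸ c) (m≤n+o⇒m∸n≤o d c (≤-trans d≤ (≤-reflexive (*-suc c (suc p)))))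
... | q , e , q≤p , e≤c , eq = suc q , e , s≤s q≤p , e≤c , (begin
  d                 ≡⟨ m+[n∸m]≡n (<⇒≤ (≰⇒> d≰c)) ⟨
  c + (d ∸ c)       ≡⟨ cong (c +_) eq ⟩
  c + (q * c + e)   ≡⟨ +-assoc c (q * c) e ⟨
  suc q * c + e     ∎)
  where open ≡-Reasoning

n<c^n : ∀ k n → n < (2 + k) ^ n
n<c^n k zero    = s≤s z≤n
n<c^n k (suc n) = begin
  2 + n                    ≤⟨ +-monoʳ-≤ 2 (m≤m+n n n) ⟩
  2 + (n + n)              ≡⟨ cong suc (+-suc n n) ⟨
  suc n + suc n            ≤⟨ +-mono-≤ (n<c^n k n) (≤-trans (n<c^n k n) (m≤m+n _ _)) ⟩
  (2 + k) ^ suc n          ∎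
  where open ≤-Reasoning

c^n+c^n≤c^[1+n] : ∀ k n → (2 + k) ^ n + (2 + k) ^ n ≤ (2 + k) ^ suc n
c^n+c^n≤c^[1+n] k n = +-monoʳ-≤ ((2 + k) ^ n) (m≤m+n _ _)

n+n≤c^n : ∀ k n → n + n ≤ (2 + k) ^ n
n+n≤c^n k zero    = z≤n
n+n≤c^n k (suc n) = ≤-trans (+-mono-≤ (n<c^n k n) (n<c^n k n)) (c^n+c^n≤c^[1+n] k n)

hasRigid-below : ∀ {p} → suc n + p ≡ (2 + k) ^ n → n ≤ t → t ≤ n + (2 + k) * suc p →
  HasRigid (2 + k) (suc n) t
hasRigid-below {n} {k} {t} {p} eq n≤t t≤
  with quotient-split (2 + k) p (t ∸ n) (m≤n+o⇒m∸n≤o t n t≤)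
... | q , e , q≤p , e≤c , t∸n≡ = subst (HasRigid (2 + k) (suc n))
  (trans (cong (n +_) (sym t∸n≡)) (m+[n∸m]≡n n≤t))
  (Construction.hasRigid k n eq q≤p e≤c)

-- The construction reaches every size from `n` to `n + κ ^ suc n - κ * n`. In the lower half, `t′`
-- is at least half of `κ ^ suc n`, hence at least `κ * n` because `n + n ≤ κ ^ n`; so `t` stays
-- within reach.
hasRigid-lowerHalf : ∀ {t′} → n ≤ t → t ≤ t′ → t + t′ ≡ (2 + k) ^ suc n → HasRigid (2 + k) (suc n) t
hasRigid-lowerHalf {n} {t} {k} {t′} n≤t t≤t′ eq = hasRigid-below p-eq n≤t
  (+-cancelʳ-≤ t′ t (n + κ * suc p) (begin
    t + t′                       ≡⟨ eq ⟩
    κ * κ ^ n                    ≡⟨ cong (κ *_) p-eq ⟨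
    κ * (suc n + p)              ≡⟨ cong (κ *_) (+-suc n p) ⟨
    κ * (n + suc p)              ≡⟨ *-distribˡ-+ κ n (suc p) ⟩
    κ * n + κ * suc p            ≡⟨ +-comm (κ * n) _ ⟩
    κ * suc p + κ * n            ≤⟨ +-mono-≤ (m≤n+m (κ * suc p) n) κn≤t′ ⟩
    n + κ * suc p + t′           ∎))
  where
  open ≤-Reasoning
  κ = 2 + k
  p = κ ^ n ∸ suc n
  p-eq : suc n + p ≡ κ ^ n
  p-eq = m+[n∸m]≡n (n<c^n k n)
  κn≤t′ : κ * n ≤ t′
  κn≤t′ = *-cancelˡ-≤ 2 (begin
    2 * (κ * n)      ≡⟨ cong (κ * n +_) (+-identityʳ (κ * n)) ⟩
    κ * n + κ * n    ≡⟨ *-distribˡ-+ κ n n ⟨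
    κ * (n + n)      ≤⟨ *-monoʳ-≤ κ (n+n≤c^n k n) ⟩
    κ ^ suc n        ≡⟨ eq ⟨
    t + t′           ≤⟨ +-monoˡ-≤ t′ t≤t′ ⟩
    t′ + t′          ≡⟨ cong (t′ +_) (+-identityʳ t′) ⟨
    2 * t′           ∎)

hasRigid-middle : ∀ {t′} → n ≤ t → n ≤ t′ → t + t′ ≡ (2 + k) ^ suc n → HasRigid (2 + k) (suc n) t
hasRigid-middle {t = t} {t′ = t′} n≤t n≤t′ eq with ≤-total t t′
... | inj₁ t≤t′ = hasRigid-lowerHalf n≤t t≤t′ eq
... | inj₂ t′≤t = rigid-complement eq′ (hasRigid-lowerHalf n≤t′ t′≤t eq′)
  where eq′ = trans (+-comm t′ t) eq

-- After transposition there are `suc t` rows, and the hypotheses place the number `s` of columns in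
-- the middle range for them.
hasRigid-narrow : suc t ≤ suc s → t + s ≤ (2 + k) ^ suc t → HasRigid (2 + k) s (suc t)
hasRigid-narrow {t} {s} {k} t<s bound = rigid-transpose (hasRigid-middle (s≤s⁻¹ t<s)
  (m+n≤o⇒m≤o∸n t bound) (m+[n∸m]≡n (m+n≤o⇒n≤o t bound)))

-- If `suc t` or the complementary size `suc t′` is at most `s`, transposition settles that one,
-- followed by a complement in the second case. Otherwise both lie in the middle range.
hasRigid-wide : ∀ {t′} → 1 ≤ s → t + s ≤ (2 + k) ^ suc t → t′ + s ≤ (2 + k) ^ suc t′ →
  suc t + suc t′ ≡ (2 + k) ^ s → HasRigid (2 + k) s (suc t)
hasRigid-wide {suc n} {t} {k} {t′} _ bound bound′ eq with t ≤? n | t′ ≤? n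
... | yes t≤n | _ = hasRigid-narrow (s≤s (m≤n⇒m≤1+n t≤n)) bound
... | no _ | yes t′≤n = rigid-complement (trans (+-comm (suc t′) (suc t)) eq)
                          (hasRigid-narrow (s≤s (m≤n⇒m≤1+n t′≤n)) bound′)
... | no t≰n | no t′≰n =
  hasRigid-middle (m≤n⇒m≤1+n (<⇒≤ (≰⇒> t≰n))) (m≤n⇒m≤1+n (<⇒≤ (≰⇒> t′≰n))) eq

wide-bound : s ≤ (2 + k) ^ t → t + s ≤ (2 + k) ^ suc t
wide-bound {s} {k} {t} s≤ = ≤-trans (+-mono-≤ (<⇒≤ (n<c^n k t)) s≤) (c^n+c^n≤c^[1+n] k t)

-- The floor logarithm

flogAux-spec : ∀ k f n → 1 ≤ n → n ≤ f →
  (2 + k) ^ flogAux f (2 + k) n ≤ n × n < (2 + k) ^ suc (flogAux f (2 + k) n)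
flogAux-spec k zero    n 1≤n n≤f = contradiction (≤-trans 1≤n n≤f) λ ()
flogAux-spec k (suc f) n 1≤n n≤f with (2 + k) ≤ᵇ n in eq
... | false = 1≤n , ≤-trans (≰⇒> (λ c≤n → subst T eq (≤⇒≤ᵇ c≤n))) (≤-reflexive (sym (*-identityʳ (2 + k))))
... | true  = lower , upper
  where
  κ = 2 + k
  q = n / κ
  y = flogAux f κ q
  κ≤n : κ ≤ n
  κ≤n = ≤ᵇ⇒≤ κ n (subst T (sym eq) _)
  -- The quotient is positive because `κ ≤ n`, and smaller than `n`, so the remaining fuel `f`
  -- suffices.
  ih = flogAux-spec k f q (m≥n⇒m/n>0 κ≤n)
         (s≤s⁻¹ (≤-trans (m/n<m n κ {{>-nonZero 1≤n}} (s≤s (s≤s z≤n))) n≤f))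
  open ≤-Reasoning
  lower : κ ^ suc y ≤ n
  lower = begin
    κ * κ ^ y  ≤⟨ *-monoʳ-≤ κ (proj₁ ih) ⟩
    κ * q      ≡⟨ *-comm κ q ⟩
    q * κ      ≤⟨ m/n*n≤m n κ ⟩
    n          ∎
  upper : n < κ ^ suc (suc y)
  upper = begin-strict
    n                  ≡⟨ m≡m%n+[m/n]*n n κ ⟩
    n % κ + q * κ      <⟨ +-monoˡ-< (q * κ) (m%n<n n κ) ⟩
    suc q * κ          ≤⟨ *-monoˡ-≤ κ (proj₂ ih) ⟩
    κ ^ suc y * κ      ≡⟨ *-comm (κ ^ suc y) κ ⟩
    κ ^ suc (suc y)    ∎

flog-spec : ∀ k n → 1 ≤ n → (2 + k) ^ ⌊log 2 + k ⌋ n ≤ n × n < (2 + k) ^ suc (⌊log 2 + k ⌋ n)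
flog-spec k n 1≤n = flogAux-spec k n n 1≤n ≤-refl

^-cancelʳ-< : ∀ k a b → (2 + k) ^ a < (2 + k) ^ b → a < b
^-cancelʳ-< k a b lt = ≰⇒> λ b≤a → <⇒≱ lt (^-monoʳ-≤ (2 + k) b≤a)

-- Bounds on the number of columns

module Logarithm (k n : ℕ) (1≤n : 1 ≤ n) where

  -- Here `σ` is the number of rows and `κ ^ x < σ ≤ κ ^ suc x`, so `x + 1` is the least number of
  -- columns that allows distinct rows.
  κ σ x : ℕ
  κ = 2 + k
  σ = suc n
  x = ⌊log κ ⌋ n

  σ≤κ^[1+x] : σ ≤ κ ^ suc x
  σ≤κ^[1+x] = proj₂ (flog-spec k n 1≤n)

  x+2≤σ : x + 2 ≤ σ
  x+2≤σ = begin
    x + 2          ≡⟨ +-comm x 2 ⟩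
    suc (suc x)    ≤⟨ s≤s (n<c^n k x) ⟩
    suc (κ ^ x)    ≤⟨ s≤s (proj₁ (flog-spec k n 1≤n)) ⟩
    σ              ∎
    where open ≤-Reasoning

  rigid⇒log< : ∀ {t} → HasRigid κ σ t → x + 1 ≤ t
  rigid⇒log< {t} N = ≤-trans (≤-reflexive (+-comm x 1)) (^-cancelʳ-< k x t
    (≤-trans (s≤s (proj₁ (flog-spec k n 1≤n))) (rigid⇒≤ (rigid-transpose N))))

  necessary : ∀ {t} → HasRigid κ σ t → x + 1 ≤ t × t + (x + 1) ≤ κ ^ σ
  necessary {t} N = rigid⇒log< N , (begin
    t + (x + 1)        ≤⟨ +-monoʳ-≤ t (rigid⇒log< (rigid-complement eq N)) ⟩
    t + (κ ^ σ ∸ t)    ≡⟨ eq ⟩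
    κ ^ σ              ∎)
    where
    open ≤-Reasoning
    eq : t + (κ ^ σ ∸ t) ≡ κ ^ σ
    eq = m+[n∸m]≡n (rigid⇒≤ N)

  -- With at least `x + 2` columns, `σ ≤ κ ^ suc x ≤ κ ^ (t - 1)`, which is what `wide-bound` turns
  -- into the hypothesis of `hasRigid-wide`. The complementary size satisfies the same bound.
  sufficient : ∀ {t} → x + 2 ≤ t → t + (x + 2) ≤ κ ^ σ → HasRigid κ σ t
  sufficient {t} x+2≤t bound = subst (HasRigid κ σ) (proj₂ t-suc)
    (hasRigid-wide (s≤s z≤n) (bounds t-suc x+2≤t) (bounds t′-suc x+2≤t′)
      (trans (cong₂ _+_ (proj₂ t-suc) (proj₂ t′-suc)) (m+[n∸m]≡n (m+n≤o⇒m≤o t bound))))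
    where
    t′ = κ ^ σ ∸ t
    x+2≤t′ : x + 2 ≤ t′
    x+2≤t′ = m+n≤o⇒m≤o∸n (x + 2) (≤-trans (≤-reflexive (+-comm (x + 2) t)) bound)
    positive : ∀ {r} → x + 2 ≤ r → ∃[ u ] suc u ≡ r
    positive {zero}  le = contradiction (≤-trans (m≤n+m 2 x) le) λ ()
    positive {suc u} le = u , refl
    t-suc = positive x+2≤t
    t′-suc = positive x+2≤t′
    bounds : ∀ {r} → ((u , _) : ∃[ u ] suc u ≡ r) → x + 2 ≤ r → u + σ ≤ κ ^ suc u
    bounds (u , refl) le = wide-bound {σ} {k} {u} (≤-trans σ≤κ^[1+x]
      (^-monoʳ-≤ κ (s≤s⁻¹ (≤-trans (≤-reflexive (+-comm 2 x)) le))))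

module Boundary (k n : ℕ) (1≤n : 1 ≤ n) (1≤x : 1 ≤ ⌊log 2 + k ⌋ n) where

  open Logarithm k n 1≤n
  private module L = Logarithm k x 1≤x

  -- Transposing gives `x + 1` rows, so that `L.x` is the logarithm of `x`. This bound and the one
  -- in `sufficient-boundary` differ by one: only `σ = κ ^ suc x - L.x - 1` is left open, which
  -- explains the recursive fifth case of the theorem.
  necessary-boundary : HasRigid κ σ (x + 1) → σ + (L.x + 1) ≤ κ ^ suc x
  necessary-boundary N =
    proj₂ (L.necessary (rigid-transpose (subst (HasRigid κ σ) (+-comm x 1) N)))

  sufficient-boundary : σ + (L.x + 2) ≤ κ ^ suc x → HasRigid κ σ (x + 1)
  sufficient-boundary bound = subst (HasRigid κ σ) (+-comm 1 x) (rigid-transpose (L.sufficient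
    (≤-trans L.x+2≤σ (≤-trans (m≤m+n (suc x) 1) (≤-trans (≤-reflexive (sym (+-suc x 1))) x+2≤σ))) bound))

hasIdentity-square : ∀ k n → ¬ (2 + k ≡ 2 × 2 + n ≡ 2) → ¬ (2 + k ≡ 2 × 2 + n ≡ 3) →
  HasIdentityColouring (2 + k) (2 + n) (2 + n)
hasIdentity-square (suc k) n             _  _  = hasIdentity-square≥3 k n
hasIdentity-square zero    zero          ¬2 _  = contradiction (refl , refl) ¬2
hasIdentity-square zero    (suc zero)    _  ¬3 = contradiction (refl , refl) ¬3
hasIdentity-square zero    (suc (suc n)) _  _  = hasIdentity-square₂ n

-- For `s ≡ t` a rigid matrix may still admit a swap, so the explicit square colourings take over;
-- they miss only sizes 2 and 3 with two colours.
rigid⇒hasIdentity′ : ∀ {c s t} → 2 ≤ c → 2 ≤ s → ¬ (c ≡ 2 × s ≡ 2 × t ≡ 2) → ¬ (c ≡ 2 × s ≡ 3 × t ≡ 3) →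
  HasRigid c s t → HasIdentityColouring c s t
rigid⇒hasIdentity′ {suc (suc k)} {suc (suc n)} {t} _ _ ¬2 ¬3 N with 2 + n ≟ t
... | no s≢t = rigid⇒hasIdentity s≢t N
... | yes refl = hasIdentity-square k n (λ (p , q) → ¬2 (p , q , q)) (λ (p , q) → ¬3 (p , q , q))
rigid⇒hasIdentity′ {suc zero}    (s≤s ())
rigid⇒hasIdentity′ {suc (suc _)} {suc zero} _ (s≤s ())

-- Truncated subtraction and the list of cases

≤∸∸ : ∀ {a m} b d → a + (b + d) ≤ m → a ≤ m ∸ b ∸ d
≤∸∸ {a} {m} b d le = ≤-trans (m+n≤o⇒m≤o∸n a le) (≤-reflexive (sym (∸-+-assoc m b d)))

-- Truncation would break this at `a = 0` with `b + d` exceeding `m`; positivity of `a` excludes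
-- that.
≤∸∸⁻¹ : ∀ {a m} b d → 1 ≤ a → a ≤ m ∸ b ∸ d → a + (b + d) ≤ m
≤∸∸⁻¹ {a} {m} b d 1≤a le = m≤o∸n⇒m+n≤o a b+d≤m le′
  where
  le′ : a ≤ m ∸ (b + d)
  le′ = ≤-trans le (≤-reflexive (∸-+-assoc m b d))
  b+d≤m : b + d ≤ m
  b+d≤m = <⇒≤ (≰⇒> λ m≤ → contradiction (≤-trans 1≤a (≤-trans le′ (≤-reflexive (m≤n⇒m∸n≡0 m≤)))) λ ())

≡∸∸ : ∀ {a m} b d → a + (b + d) ≡ m → a ≡ m ∸ b ∸ d
≡∸∸ {a} b d refl = sym (trans (∸-+-assoc (a + (b + d)) b d) (m+n∸n≡m a (b + d)))

≡∸∸⁻¹ : ∀ {a m} b d → b + d ≤ m → a ≡ m ∸ b ∸ d → a + (b + d) ≡ m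
≡∸∸⁻¹ {m = m} b d le refl = trans (cong (_+ (b + d)) (∸-+-assoc m b d)) (m∸n+n≡m le)

-- For `c ≥ 2` and `s ≥ 1` the alternatives put `s` into disjoint ranges, so a plain sum expresses
-- "exactly one".
Characterization : ℕ → ℕ → ℕ → Set
Characterization c s t =
  let x = ⌊log c ⌋ (s ∸ 1) in
    ( (s ≡ 1 × 2 ≤ t × t ≤ c)
    ⊎ ((2 ≤ s × s ≤ c × 1 ≤ t × t ≤ c ^ s ∸ 1) × ¬ (c ≡ 2 × s ≡ 2 × t ≡ 2))
    ⊎ (c < s × s ≤ c ^ (1 + x) ∸ ⌊log c ⌋ x ∸ 2 × x + 1 ≤ t × t ≤ c ^ s ∸ x ∸ 1)
    ⊎ (c < s × c ^ (1 + x) ∸ ⌊log c ⌋ x ≤ s × x + 2 ≤ t × t ≤ c ^ s ∸ x ∸ 2)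
    ⊎ ((c < s × s ≡ c ^ (1 + x) ∸ ⌊log c ⌋ x ∸ 1 ×
    ((x + 2 ≤ t × t ≤ c ^ s ∸ x ∸ 2)
    ⊎ ((t ≡ x + 1 ⊎ t ≡ c ^ s ∸ x ∸ 1) × HasIdentityColouring c (x + 1) s)))
    × ¬ (c ≡ 2 × s ≡ 3 × t ≡ 3)) )

-- Exceptional sizes

hasIdentity⇒¬exception₂ : ∀ {c s t} → HasIdentityColouring c s t → ¬ (c ≡ 2 × s ≡ 2 × t ≡ 2)
hasIdentity⇒¬exception₂ H (refl , refl , refl) = ¬hasIdentity₂₂ H

hasIdentity⇒¬exception₃ : ∀ {c s t} → HasIdentityColouring c s t → ¬ (c ≡ 2 × s ≡ 3 × t ≡ 3)
hasIdentity⇒¬exception₃ H (refl , refl , refl) = ¬hasIdentity₃₃ H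

¬hasIdentity₁₁ : ∀ {c} → ¬ HasIdentityColouring c 1 1
¬hasIdentity₁₁ (M , ident) = identity⇒¬swapped M ident Perm.id Perm.id λ { 0F 0F → refl }

-- More rows than colours

module LargeSide (k n t : ℕ) (c<s : 2 + k < suc n) where

  private
    1≤n : 1 ≤ n
    1≤n = ≤-trans (s≤s z≤n) (s≤s⁻¹ c<s)

  open Logarithm k n 1≤n

  private
    p = κ ^ suc x
    L = ⌊log κ ⌋ x

    -- Follows from `κ ^ 1 < σ ≤ κ ^ suc x`, and makes `Boundary` applicable.
    1≤x : 1 ≤ x
    1≤x = s≤s⁻¹ (^-cancelʳ-< k 1 (suc x) (≤-trans
      (s≤s (≤-reflexive (*-identityʳ κ))) (≤-trans c<s σ≤κ^[1+x])))

    open Boundary k n 1≤n 1≤x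

    Extreme : Set
    Extreme = t ≡ x + 1 ⊎ t + (x + 1) ≡ κ ^ σ

    extreme⇒boundary : Extreme → HasRigid κ σ t → HasRigid κ σ (x + 1)
    extreme⇒boundary (inj₁ eq) N = subst (HasRigid κ σ) eq N
    extreme⇒boundary (inj₂ eq) N = rigid-complement eq N

    boundary⇒extreme : Extreme → HasRigid κ σ (x + 1) → HasRigid κ σ t
    boundary⇒extreme (inj₁ eq) N = subst (HasRigid κ σ) (sym eq) N
    boundary⇒extreme (inj₂ eq) N = rigid-complement (trans (+-comm (x + 1) t) eq) N

    Inner : Set
    Inner = x + 2 ≤ t × t ≤ κ ^ σ ∸ x ∸ 2

    extreme-or-inner : x + 1 ≤ t → t + (x + 1) ≤ κ ^ σ → Extreme ⊎ Inner
    extreme-or-inner lower upper with m≤n⇒m<n∨m≡n lower | m≤n⇒m<n∨m≡n upper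
    ... | inj₂ eq | _       = inj₁ (inj₁ (sym eq))
    ... | inj₁ _  | inj₂ eq = inj₁ (inj₂ eq)
    ... | inj₁ l  | inj₁ u  = inj₂ (≤-trans x+2≡ l , ≤∸∸ x 2
      (≤-trans (+-monoʳ-≤ t x+2≡) (≤-trans (≤-reflexive (+-suc t (x + 1))) u)))
      where
      x+2≡ : x + 2 ≤ suc (x + 1)
      x+2≡ = ≤-reflexive (+-suc x 1)

    inner⇒rigid : Inner → HasRigid κ σ t
    inner⇒rigid (lower , upper) = sufficient lower (≤∸∸⁻¹ x 2 (≤-trans (m≤n⇒m≤o+n x (s≤s z≤n)) lower) upper)

    x+1≤κ^σ : x + 1 ≤ κ ^ σ
    x+1≤κ^σ = ≤-trans (+-monoʳ-≤ x (s≤s z≤n)) (≤-trans x+2≤σ (<⇒≤ (n<c^n k σ)))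

    σ≢x+1 : x + 1 ≢ σ
    σ≢x+1 eq = 1+n≰n (≤-trans (≤-reflexive (trans (cong suc (sym eq)) (sym (+-suc x 1)))) x+2≤σ)

    -- The size is not square because `x + 2 ≤ σ`, so swaps cannot occur.
    boundary⇔ : HasRigid κ σ (x + 1) ⇔ HasIdentityColouring κ (x + 1) σ
    boundary⇔ = mk⇔
      (λ N → subst (λ y → HasIdentityColouring κ y σ) (+-comm 1 x)
        (rigid⇒hasIdentity (λ eq → σ≢x+1 (trans (+-comm x 1) eq))
          (rigid-transpose (subst (HasRigid κ σ) (+-comm x 1) N))))
      (λ H → rigid-transpose (hasIdentity⇒rigid H))

    extreme-rigid : Extreme ⊎ Inner → HasIdentityColouring κ σ t →
      Inner ⊎ ((t ≡ x + 1 ⊎ t ≡ κ ^ σ ∸ x ∸ 1) × HasIdentityColouring κ (x + 1) σ)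
    extreme-rigid (inj₂ inner) H = inj₁ inner
    extreme-rigid (inj₁ ext)   H = inj₂ (Sum.map₂ (≡∸∸ x 1) ext ,
      Equivalence.to boundary⇔ (extreme⇒boundary ext (hasIdentity⇒rigid H)))

    inner-of-large : p < σ + (L + 1) → HasRigid κ σ t → Extreme ⊎ Inner → Inner
    inner-of-large gt N (inj₂ inner) = inner
    inner-of-large gt N (inj₁ ext)   =
      contradiction (necessary-boundary (extreme⇒boundary ext N)) (<⇒≱ gt)

    iii-bound : σ + (L + 1) < p → σ ≤ p ∸ L ∸ 2
    iii-bound lt = ≤∸∸ L 2
      (≤-trans (≤-reflexive (trans (cong (σ +_) (+-suc L 1)) (+-suc σ (L + 1)))) lt)

    iv-bound : p < σ + (L + 1) → p ∸ L ≤ σ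
    iv-bound gt = m≤n+o⇒m∸n≤o p L (s≤s⁻¹ (≤-trans gt (≤-reflexive (begin
        σ + (L + 1)     ≡⟨ cong (σ +_) (+-comm L 1) ⟩
        σ + suc L       ≡⟨ +-suc σ L ⟩
        suc (σ + L)     ≡⟨ cong suc (+-comm σ L) ⟩
        suc (L + σ)     ∎))))
      where open ≡-Reasoning

  -- Comparing `σ` with `p - (L + 1)`, the value left open by the two boundary bounds, gives the
  -- third, fifth and fourth case, in this order.
  large-forward : HasIdentityColouring κ σ t → Characterization κ σ t
  large-forward H = by-size (<-cmp (σ + (L + 1)) p)
    where
    N = hasIdentity⇒rigid H
    lower = proj₁ (necessary N)
    upper = proj₂ (necessary N)
    ext⊎inner = extreme-or-inner lower upper

    by-size : Tri (σ + (L + 1) < p) (σ + (L + 1) ≡ p) (p < σ + (L + 1)) → Characterization κ σ t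
    by-size (tri< lt _ _) = inj₂ (inj₂ (inj₁ (c<s , iii-bound lt , lower , ≤∸∸ x 1 upper)))
    by-size (tri≈ _ eq _) = inj₂ (inj₂ (inj₂ (inj₂
      ((c<s , ≡∸∸ L 1 eq , extreme-rigid ext⊎inner H) , hasIdentity⇒¬exception₃ H))))
    by-size (tri> _ _ gt) = inj₂ (inj₂ (inj₂ (inj₁
      (c<s , iv-bound gt , inner-of-large gt N ext⊎inner))))

  large-iii : σ ≤ p ∸ L ∸ 2 → x + 1 ≤ t → t ≤ κ ^ σ ∸ x ∸ 1 → HasRigid κ σ t
  large-iii σ≤ lower upper
    with extreme-or-inner lower (≤∸∸⁻¹ x 1 (≤-trans (m≤n+m 1 x) lower) upper)
  ... | inj₂ inner = inner⇒rigid inner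
  ... | inj₁ ext   = boundary⇒extreme ext (sufficient-boundary (≤∸∸⁻¹ L 2 (s≤s z≤n) σ≤))

  large-iv : x + 2 ≤ t → t ≤ κ ^ σ ∸ x ∸ 2 → HasRigid κ σ t
  large-iv lower upper = inner⇒rigid (lower , upper)

  large-v : (t ≡ x + 1 ⊎ t ≡ κ ^ σ ∸ x ∸ 1) → HasIdentityColouring κ (x + 1) σ → HasRigid κ σ t
  large-v ext H = boundary⇒extreme (Sum.map₂ (≡∸∸⁻¹ x 1 x+1≤κ^σ) ext) (Equivalence.from boundary⇔ H)

-- At most as many rows as colours, and the combination of all cases

one-forward : ∀ {c t} → 1 ≤ t → HasIdentityColouring c 1 t → Characterization c 1 t
one-forward {c} {suc zero}    _ H = contradiction H ¬hasIdentity₁₁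
one-forward {c} {suc (suc t)} _ H = inj₁ (refl , s≤s (s≤s z≤n) ,
  ≤-trans (rigid⇒≤ (hasIdentity⇒rigid H)) (≤-reflexive (*-identityʳ c)))

one-backward : ∀ k {t} → 2 ≤ t → t ≤ 2 + k → HasIdentityColouring (2 + k) 1 t
one-backward k {t} 2≤t t≤c = rigid⇒hasIdentity (<⇒≢ 2≤t) (hasRigid-middle z≤n z≤n
  (m+[n∸m]≡n (≤-trans t≤c (≤-reflexive (sym (*-identityʳ (2 + k)))))))

-- For `s ≤ c` the hypothesis of `hasRigid-wide` holds down to a single column, where it reads
-- `s ≤ c`; so no extreme sizes remain.
small-bound : ∀ {k s} t → s ≤ 2 + k → t + s ≤ (2 + k) ^ suc t
small-bound {k} zero    s≤c = ≤-trans s≤c (≤-reflexive (sym (*-identityʳ (2 + k))))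
small-bound {k} {s} (suc t) s≤c = wide-bound {s} {k} {suc t}
  (≤-trans s≤c (m≤m*n (2 + k) ((2 + k) ^ t) {{m^n≢0 (2 + k) t}}))

small-backward : ∀ {k s t} → 1 ≤ s → s ≤ 2 + k → 1 ≤ t → t ≤ (2 + k) ^ s ∸ 1 → HasRigid (2 + k) s t
small-backward {k} {s} {suc t} 1≤s s≤c _ t≤ = hasRigid-wide 1≤s (small-bound t s≤c) (small-bound t′ s≤c)
  (trans (+-suc (suc t) t′) (trans (cong suc (m+[n∸m]≡n t≤)) (m+[n∸m]≡n (m^n>0 (2 + k) s))))
  where
  t′ = (2 + k) ^ s ∸ 1 ∸ suc t

small-forward : ∀ {k n t} → 1 ≤ n → suc n ≤ 2 + k → 1 ≤ t →
  HasIdentityColouring (2 + k) (suc n) t → Characterization (2 + k) (suc n) t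
small-forward {k} {n} 1≤n s≤c 1≤t H = inj₂ (inj₁
  ((s≤s 1≤n , s≤c , 1≤t , m+n≤o⇒m≤o∸n _ (≤-trans (+-monoʳ-≤ _ (m≤n+m 1 (Logarithm.x k n 1≤n)))
     (proj₂ (Logarithm.necessary k n 1≤n (hasIdentity⇒rigid H))))) ,
   hasIdentity⇒¬exception₂ H))

forward : ∀ k n t → 1 ≤ t → HasIdentityColouring (2 + k) (suc n) t → Characterization (2 + k) (suc n) t
forward k zero    t 1≤t H = one-forward 1≤t H
forward k (suc n) t 1≤t H with 2 + n ≤? 2 + k
... | yes s≤c = small-forward (s≤s z≤n) s≤c 1≤t H
... | no  s≰c = LargeSide.large-forward k (suc n) t (≰⇒> s≰c) H

no-exception₂ : ∀ {c s t} → c < s → ¬ (c ≡ 2 × s ≡ 2 × t ≡ 2)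
no-exception₂ c<s (refl , refl , _) = 1+n≰n c<s

backward : ∀ k n t → Characterization (2 + k) (suc n) t → HasIdentityColouring (2 + k) (suc n) t
backward k n t (inj₁ (refl , 2≤t , t≤c)) = one-backward k 2≤t t≤c
backward k n t (inj₂ (inj₁ ((2≤s , s≤c , 1≤t , t≤) , ¬2))) =
  rigid⇒hasIdentity′ (s≤s (s≤s z≤n)) 2≤s ¬2
    (λ { (refl , refl , _) → 1+n≰n s≤c })
    (small-backward (s≤s z≤n) s≤c 1≤t t≤)
backward k n t (inj₂ (inj₂ (inj₁ (c<s , s≤ , lower , upper)))) =
  rigid⇒hasIdentity′ (s≤s (s≤s z≤n)) (≤-trans (s≤s (s≤s z≤n)) (<⇒≤ c<s)) (no-exception₂ c<s)
    -- For `c = 2` and `s = 3` one has `x = 1`, so the third case would claim `3 ≤ 2`; the fourth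
    -- would claim `4 ≤ 3`. The size-3 exception thus belongs to the fifth.
    (λ { (refl , refl , _) → 1+n≰n s≤ })
    (LargeSide.large-iii k n t c<s s≤ lower upper)
backward k n t (inj₂ (inj₂ (inj₂ (inj₁ (c<s , ≤s , lower , upper))))) =
  rigid⇒hasIdentity′ (s≤s (s≤s z≤n)) (≤-trans (s≤s (s≤s z≤n)) (<⇒≤ c<s)) (no-exception₂ c<s)
    (λ { (refl , refl , _) → 1+n≰n ≤s })
    (LargeSide.large-iv k n t c<s lower upper)
backward k n t (inj₂ (inj₂ (inj₂ (inj₂ ((c<s , s≡ , range) , ¬3))))) =
  rigid⇒hasIdentity′ (s≤s (s≤s z≤n)) (≤-trans (s≤s (s≤s z≤n)) (<⇒≤ c<s)) (no-exception₂ c<s) ¬3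
    (rigid range)
  where
  rigid : _ → HasRigid (2 + k) (suc n) t
  rigid (inj₁ (lower , upper)) = LargeSide.large-iv k n t c<s lower upper
  rigid (inj₂ (ext , H))       = LargeSide.large-v k n t c<s ext H

theorem1 : (c s t : ℕ) → 2 ≤ c → 1 ≤ s → 1 ≤ t →
  let x = ⌊log c ⌋ (s ∸ 1) in
  HasIdentityColouring c s t ⇔
    ( (s ≡ 1 × 2 ≤ t × t ≤ c)
    ⊎ ((2 ≤ s × s ≤ c × 1 ≤ t × t ≤ c ^ s ∸ 1) × ¬ (c ≡ 2 × s ≡ 2 × t ≡ 2))
    ⊎ (c < s × s ≤ c ^ (1 + x) ∸ ⌊log c ⌋ x ∸ 2 × x + 1 ≤ t × t ≤ c ^ s ∸ x ∸ 1)
    ⊎ (c < s × c ^ (1 + x) ∸ ⌊log c ⌋ x ≤ s × x + 2 ≤ t × t ≤ c ^ s ∸ x ∸ 2)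
    ⊎ ((c < s × s ≡ c ^ (1 + x) ∸ ⌊log c ⌋ x ∸ 1 ×
         ((x + 2 ≤ t × t ≤ c ^ s ∸ x ∸ 2)
         ⊎ ((t ≡ x + 1 ⊎ t ≡ c ^ s ∸ x ∸ 1) × HasIdentityColouring c (x + 1) s)))
       × ¬ (c ≡ 2 × s ≡ 3 × t ≡ 3)) )
theorem1 (suc (suc k)) (suc n) t _ _ 1≤t = mk⇔ (forward k n t 1≤t) (backward k n t)
theorem1 (suc zero) _ _ (s≤s ())
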